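{- Every cube in $\mathcal{C}^3_3(v,1,0)$ is equivalent to the cube $I$ defined by $I(x,y,z)=1$ if $x=y=z$ and $I(x,y,z)=0$ otherwise, for $x,y,z\in\{1,\dots,v\}$.
   Context: A $v\times v\times v$ array is a function on $\{1,\dots,v\}^3$. A layer is a 2-dimensional subarray obtained by fixing one of the three coordinates. Two layers are parallel if they fix the same coordinate, to different values; their scalar product is the sum over all positions of the product of corresponding entries. $\mathcal{C}^3_3(v,k,\lambda)$ is the set of $v\times v\times v$ arrays over $\{0,1\}$ such that every layer (in each of the three directions) contains exactly $k$ ones and every two parallel layers have scalar product $\lambda$. Two cubes are equivalent if one can be transformed into the other by isotopy (permuting the symbols $\{1,\dots,v\}$ independently in each of the three coordinates) and conjugation (permuting the order of the three coordinates). -}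

module Defs where

open import Data.Bool.Base using (if_then_else_)
open import Data.Fin.Base using (Fin; toℕ)
open import Data.Fin.Patterns using (0F; 1F)
open import Data.Fin.Permutation using (Permutation′; _⟨$⟩ʳ_)
open import Data.Fin.Properties using (_≟_)
open import Data.Nat.Base using (ℕ; _*_)
open import Data.Nat.Properties using (+-0-monoid)
open import Data.Product.Base using (∃₂)
open import Data.Vec.Base using (Vec; []; _∷_; lookup; tabulate; insertAt)
open import Relation.Binary.PropositionalEquality.Core using (_≡_; _≢_; _≗_)
open import Relation.Nullary.Decidable using (does; _×-dec_)

open import Algebra.Properties.Monoid.Sum +-0-monoid using (sum-syntax)

-- Positions are vectors rather than functions Fin 3 → Fin v, so that arrays
-- automatically respect equality of positions without function extensionality.
Array : ℕ → Set
Array v = Vec (Fin v) 3 → Fin 2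

Matrix : ℕ → Set
Matrix v = Fin v → Fin v → Fin 2

-- The d-th coordinate is fixed to a; the other two keep their order.
layer : ∀ {v} → Array v → Fin 3 → Fin v → Matrix v
layer A d a y z = A (insertAt (y ∷ z ∷ []) d a)

∑ᵐ : ∀ v → (Fin v → Fin v → ℕ) → ℕ
∑ᵐ v f = ∑[ y < v ] ∑[ z < v ] f y z

-- Entries are 0 or 1, so their sum counts the ones.
ones : ∀ {v} → Matrix v → ℕ
ones {v} L = ∑ᵐ v λ y z → toℕ (L y z)

scalarProduct : ∀ {v} → Matrix v → Matrix v → ℕ
scalarProduct {v} L M = ∑ᵐ v λ y z → toℕ (L y z) * toℕ (M y z)

-- Membership in 𝒞³₃(v,k,λ), with μ in place of the reserved symbol λ.
record 𝒞³₃ (v k μ : ℕ) (A : Array v) : Set where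
  field
    layer-ones    : ∀ d a → ones (layer A d a) ≡ k
    layer-product : ∀ d {a b} → a ≢ b →
                    scalarProduct (layer A d a) (layer A d b) ≡ μ

isotope : ∀ {v} → (Fin 3 → Permutation′ v) → Array v → Array v
isotope π A p = A (tabulate λ d → π d ⟨$⟩ʳ lookup p d)

conjugate : ∀ {v} → Permutation′ 3 → Array v → Array v
conjugate σ A p = A (tabulate λ d → lookup p (σ ⟨$⟩ʳ d))

-- Conjugation carries isotopies to isotopies, so any sequence of the two kinds
-- of operation amounts to one conjugation followed by one isotopy. Arrays are
-- compared entrywise.
Equivalent : ∀ {v} → Array v → Array v → Set
Equivalent A B = ∃₂ λ π σ → isotope π (conjugate σ A) ≗ B

I : ∀ v → Array v
I v (x ∷ y ∷ z ∷ []) = if does (x ≟ y ×-dec y ≟ z) then 1F else 0F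

{-# OPTIONS --safe #-}
-- A layer with a single one makes every coordinate a key: a one of A is
-- determined by any single coordinate. Hence the d-th coordinate of the one
-- whose first coordinate is x is a bijective function π d of x, and the ones of
-- A are exactly the points (π 0 x , π 1 x , π 2 x).
module Submission where

open import Defs
open import Data.Bool.Base using (if_then_else_)
open import Data.Fin.Base using (Fin; zero; suc; toℕ)
open import Data.Fin.Patterns using (0F; 1F; 2F)
open import Data.Fin.Permutation using (Permutation′; permutation; id; _⟨$⟩ʳ_; inverseˡ)
open import Data.Fin.Properties using (_≟_; toℕ-injective)
open import Data.Nat.Base using (ℕ; zero; suc)
open import Data.Nat.Properties using (+-0-monoid; m+n≡0⇒m≡0; m+n≡0⇒n≡0; suc-injective; 0≢1+n)
open import Data.Product.Base using (∃; ∃₂; _×_; _,_; proj₁; proj₂)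
open import Data.Vec.Base using (Vec; []; _∷_; lookup; tabulate; insertAt; removeAt)
open import Data.Vec.Properties using (insertAt-lookup; insertAt-removeAt; lookup∘tabulate; tabulate∘lookup)
open import Relation.Binary.PropositionalEquality
  using (_≡_; _≢_; refl; sym; trans; cong; cong₂; module ≡-Reasoning)
open import Relation.Nullary.Decidable using (Dec; yes; no; does; _×-dec_)
open import Relation.Nullary.Negation using (contradiction)

open import Algebra.Properties.Monoid.Sum +-0-monoid using (sum)

sum≡0⇒≡0 : ∀ {n} (f : Fin n → ℕ) → sum f ≡ 0 → ∀ i → f i ≡ 0
sum≡0⇒≡0 f eq zero    = m+n≡0⇒m≡0 (f zero) eq
sum≡0⇒≡0 f eq (suc i) = sum≡0⇒≡0 (λ j → f (suc j)) (m+n≡0⇒n≡0 (f zero) eq) i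

-- Uniqueness is stated for nonzero terms rather than terms equal to 1, because it is also applied
-- to row sums, about which a single one in the row only shows that they are not 0.
sum≡1⇒unique : ∀ {n} (f : Fin n → ℕ) → sum f ≡ 1 →
               ∃ λ i → f i ≡ 1 × (∀ j → f j ≢ 0 → j ≡ i)
sum≡1⇒unique {suc n} f eq with f zero in f0
... | zero = suc i , fi≡1 , unique
  where
  tail = sum≡1⇒unique (λ j → f (suc j)) eq
  i    = proj₁ tail
  fi≡1 = proj₁ (proj₂ tail)

  unique : ∀ j → f j ≢ 0 → j ≡ suc i
  unique zero    fj≢0 = contradiction f0 fj≢0
  unique (suc j) fj≢0 = cong suc (proj₂ (proj₂ tail) j fj≢0)
... | suc m = zero , trans f0 (cong suc m≡0) , unique
  where
  m≡0 : m ≡ 0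
  m≡0 = m+n≡0⇒m≡0 m (suc-injective eq)

  unique : ∀ j → f j ≢ 0 → j ≡ zero
  unique zero    _    = refl
  unique (suc j) fj≢0 = contradiction
    (sum≡0⇒≡0 (λ j → f (suc j)) (m+n≡0⇒n≡0 m (suc-injective eq)) j) fj≢0

ones≡1⇒unique : ∀ {v} (L : Matrix v) → ones L ≡ 1 →
                ∃₂ λ y z → L y z ≡ 1F × (∀ y′ z′ → L y′ z′ ≡ 1F → y′ ≡ y × z′ ≡ z)
ones≡1⇒unique L eq
  with y , row≡1 , row-unique ← sum≡1⇒unique (λ y → sum λ z → toℕ (L y z)) eq
  with z , Lyz≡1 , unique ← sum≡1⇒unique (λ z → toℕ (L y z)) row≡1
  = y , z , toℕ-injective Lyz≡1 , both
  where
  entry≢0 : ∀ {y z} → L y z ≡ 1F → toℕ (L y z) ≢ 0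
  entry≢0 L≡1 L≡0 = 0≢1+n (trans (sym L≡0) (cong toℕ L≡1))

  both : ∀ y′ z′ → L y′ z′ ≡ 1F → y′ ≡ y × z′ ≡ z
  both y′ z′ L≡1
    -- A one at (`y′`, `z′`) keeps row `y′` from summing to 0, so this is the only row with nonzero
    -- sum; uniqueness inside that row then fixes the column.
    with refl ← row-unique y′ (λ row≡0 →
           entry≢0 L≡1 (sum≡0⇒≡0 (λ z → toℕ (L y′ z)) row≡0 z′))
    = refl , unique z′ (entry≢0 L≡1)

module _ {v} (A : Array v) (layer-ones : ∀ d a → ones (layer A d a) ≡ 1) where

  private
    support : ∀ d a → ∃₂ λ y z → layer A d a y z ≡ 1F ×
              (∀ y′ z′ → layer A d a y′ z′ ≡ 1F → y′ ≡ y × z′ ≡ z)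
    support d a = ones≡1⇒unique (layer A d a) (layer-ones d a)

  one : Fin 3 → Fin v → Vec (Fin v) 3
  one d a = let y , z , _ = support d a in insertAt (y ∷ z ∷ []) d a

  one-value : ∀ d a → A (one d a) ≡ 1F
  one-value d a = let _ , _ , value , _ = support d a in value

  lookup-one : ∀ d a → lookup (one d a) d ≡ a
  lookup-one d a = insertAt-lookup _ d a

  -- Splitting `p` into its `d`-th coordinate and the remaining two exhibits it as an entry of the
  -- layer through `p` in direction `d`, and that layer has a single one.
  one-unique : ∀ d p → A p ≡ 1F → p ≡ one d (lookup p d)
  one-unique d p Ap≡1 with removeAt p d | insertAt-removeAt p d
  ... | y ∷ z ∷ [] | eq =
    let _ , _ , _ , unique = support d (lookup p d)
        y≡ , z≡ = unique y z (trans (cong A eq) Ap≡1)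
    in trans (sym eq) (cong₂ (λ y z → insertAt (y ∷ z ∷ []) d (lookup p d)) y≡ z≡)

  transfer : Fin 3 → Fin 3 → Fin v → Fin v
  transfer d e a = lookup (one d a) e

  -- The point `one d a` is also the one picked out by its own `e`-th coordinate, so going back
  -- reads the `d`-th coordinate of the same point.
  transfer-inverse : ∀ d e a → transfer e d (transfer d e a) ≡ a
  transfer-inverse d e a = trans
    (cong (λ p → lookup p d) (sym (one-unique e (one d a) (one-value d a))))
    (lookup-one d a)

  π : Fin 3 → Permutation′ v
  π d = permutation (transfer 0F d) (transfer d 0F)
          (transfer-inverse d 0F) (transfer-inverse 0F d)

  isotope-diagonal : ∀ x → isotope π A (x ∷ x ∷ x ∷ []) ≡ 1F
  isotope-diagonal x = trans (cong A (tabulate∘lookup (one 0F x))) (one-value 0F x)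

  -- The image `q` of `p` is a one of `A`, so each of its coordinates determines all of `q`. Hence
  -- undoing any `π d` on the `d`-th coordinate of `q` yields the same value, its first coordinate.
  isotope≡1⇒constant : ∀ p → isotope π A p ≡ 1F → ∃ λ x → ∀ d → lookup p d ≡ x
  isotope≡1⇒constant p eq = lookup q 0F , λ d → begin
    lookup p d                               ≡⟨ inverseˡ (π d) ⟨
    transfer d 0F (π d ⟨$⟩ʳ lookup p d)      ≡⟨ cong (transfer d 0F) (lookup∘tabulate (λ e → π e ⟨$⟩ʳ lookup p e) d) ⟨
    lookup (one d (lookup q d)) 0F           ≡⟨ cong (λ r → lookup r 0F) (one-unique d q eq) ⟨
    lookup q 0F                              ∎
    where
    open ≡-Reasoning
    q = tabulate λ d → π d ⟨$⟩ʳ lookup p d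

≡if-does : ∀ {p} {P : Set p} (P? : Dec P) {b : Fin 2} →
           (P → b ≡ 1F) → (b ≡ 1F → P) → b ≡ (if does P? then 1F else 0F)
≡if-does (yes p) {b}  P⇒b _   = P⇒b p
≡if-does (no ¬p) {0F} _   _   = refl
≡if-does (no ¬p) {1F} _   b⇒P = contradiction (b⇒P refl) ¬p

proposition2p6 : ∀ (v : ℕ) (A : Array v) → 𝒞³₃ v 1 0 A → Equivalent A (I v)
-- No reordering of coordinates is required: with `id`, the conjugation disappears by computation,
-- since lookups in a tabulated triple reduce.
proposition2p6 v A A∈𝒞 = π A layer-ones , id , λ { (x ∷ y ∷ z ∷ []) →
  ≡if-does (x ≟ y ×-dec y ≟ z)
    (λ { (refl , refl) → isotope-diagonal A layer-ones x })
    (λ eq → let _ , constant = isotope≡1⇒constant A layer-ones (x ∷ y ∷ z ∷ []) eq in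
       trans (constant 0F) (sym (constant 1F)) ,
       trans (constant 1F) (sym (constant 2F))) }
  where
  open 𝒞³₃ A∈𝒞 using (layer-ones)
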